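{- A cograph $G$ has outcome $\mathcal D$ in the Maker-Breaker domination game if and only if $G$ admits a pairing dominating set.
   Context: Cographs are the graphs that can be built from single vertices by repeatedly taking disjoint unions and joins (equivalently, $P_4$-free graphs). Given a graph $G=(V,E)$, a pairing dominating set is a set of pairs of vertices $\{(u_1,v_1),\ldots,(u_k,v_k)\}$, where all $2k$ vertices are distinct, such that $V=\bigcup_{i=1}^k \big(N[u_i]\cap N[v_i]\big)$, with $N[x]$ the closed neighborhood of $x$. The Maker-Breaker domination game on $G$: Dominator and Staller alternately choose a not-yet-chosen vertex (no passing), starting with all vertices unchosen; when all vertices are chosen, Dominator wins if his vertices form a dominating set of $G$, otherwise Staller wins. Outcome $\mathcal D$ means Dominator has a winning strategy both as first and as second player. -}

module Defs where

open import Data.Empty using (⊥)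
open import Data.Fin using (Fin; splitAt)
open import Data.Maybe using (Maybe; just; nothing)
open import Data.Nat using (ℕ; _+_)
open import Data.Product using (_×_; ∃)
open import Data.Sum using (_⊎_; inj₁; inj₂; [_,_]′)
open import Data.Unit using (⊤; tt)
open import Data.Vec using (Vec; lookup; replicate; _[_]≔_)
open import Function.Base using (_on_)
open import Function.Bundles using (_↔_; _⇔_; Inverse)
open import Function.Definitions using (Injective)
open import Level using (0ℓ)
open import Relation.Binary.Core using (Rel)
open import Relation.Binary.Definitions using (Symmetric; Irreflexive; Decidable)
open import Relation.Binary.PropositionalEquality using (_≡_; refl)
open import Relation.Nullary using (¬_; yes; no)
open import Relation.Unary using (Pred; Universal; _∩_; ⋃)

record Graph (n : ℕ) : Set₁ where
  field
    Adj    : Rel (Fin n) 0ℓ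
    adj?   : Decidable Adj
    sym    : Symmetric Adj
    irrefl : Irreflexive _≡_ Adj

open Graph

infix 4 _≅_

record _≅_ {m n : ℕ} (G : Graph m) (H : Graph n) : Set where
  field
    bijection : Fin m ↔ Fin n
    preserves : ∀ u v →
      Adj G u v ⇔ Adj H (Inverse.to bijection u) (Inverse.to bijection v)

K₁ : Graph 1
K₁ = record
  { Adj    = λ _ _ → ⊥
  ; adj?   = λ _ _ → no λ ()
  ; sym    = λ ()
  ; irrefl = λ _ ()
  }

-- The vertices of a disjoint union or a join are Fin (m + n): `splitAt m`
-- sends a vertex to the vertex of G or of H that it stands for.
module _ {m n : ℕ} (G : Graph m) (H : Graph n) where

  UnionAdj : Rel (Fin m ⊎ Fin n) 0ℓ
  UnionAdj (inj₁ u) (inj₁ v) = Adj G u v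
  UnionAdj (inj₁ _) (inj₂ _) = ⊥
  UnionAdj (inj₂ _) (inj₁ _) = ⊥
  UnionAdj (inj₂ u) (inj₂ v) = Adj H u v

  JoinAdj : Rel (Fin m ⊎ Fin n) 0ℓ
  JoinAdj (inj₁ u) (inj₁ v) = Adj G u v
  JoinAdj (inj₁ _) (inj₂ _) = ⊤
  JoinAdj (inj₂ _) (inj₁ _) = ⊤
  JoinAdj (inj₂ u) (inj₂ v) = Adj H u v

  unionAdj? : Decidable UnionAdj
  unionAdj? (inj₁ u) (inj₁ v) = adj? G u v
  unionAdj? (inj₁ _) (inj₂ _) = no λ ()
  unionAdj? (inj₂ _) (inj₁ _) = no λ ()
  unionAdj? (inj₂ u) (inj₂ v) = adj? H u v

  joinAdj? : Decidable JoinAdj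
  joinAdj? (inj₁ u) (inj₁ v) = adj? G u v
  joinAdj? (inj₁ _) (inj₂ _) = yes tt
  joinAdj? (inj₂ _) (inj₁ _) = yes tt
  joinAdj? (inj₂ u) (inj₂ v) = adj? H u v

  unionAdj-sym : ∀ x y → UnionAdj x y → UnionAdj y x
  unionAdj-sym (inj₁ _) (inj₁ _) = sym G
  unionAdj-sym (inj₂ _) (inj₂ _) = sym H

  joinAdj-sym : ∀ x y → JoinAdj x y → JoinAdj y x
  joinAdj-sym (inj₁ _) (inj₁ _) = sym G
  joinAdj-sym (inj₁ _) (inj₂ _) = λ _ → tt
  joinAdj-sym (inj₂ _) (inj₁ _) = λ _ → tt
  joinAdj-sym (inj₂ _) (inj₂ _) = sym H

  unionAdj-irrefl : ∀ x → ¬ UnionAdj x x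
  unionAdj-irrefl (inj₁ _) = irrefl G refl
  unionAdj-irrefl (inj₂ _) = irrefl H refl

  joinAdj-irrefl : ∀ x → ¬ JoinAdj x x
  joinAdj-irrefl (inj₁ _) = irrefl G refl
  joinAdj-irrefl (inj₂ _) = irrefl H refl

  disjointUnion : Graph (m + n)
  disjointUnion = record
    { Adj    = UnionAdj on splitAt m
    ; adj?   = λ u v → unionAdj? (splitAt m u) (splitAt m v)
    ; sym    = λ {u} {v} → unionAdj-sym (splitAt m u) (splitAt m v)
    ; irrefl = λ { {u} refl → unionAdj-irrefl (splitAt m u) }
    }

  join : Graph (m + n)
  join = record
    { Adj    = JoinAdj on splitAt m
    ; adj?   = λ u v → joinAdj? (splitAt m u) (splitAt m v)
    ; sym    = λ {u} {v} → joinAdj-sym (splitAt m u) (splitAt m v)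
    ; irrefl = λ { {u} refl → joinAdj-irrefl (splitAt m u) }
    }

data IsCograph : ∀ {n} → Graph n → Set₁ where
  single-vertex  : IsCograph K₁
  disjoint-union : ∀ {m n} {G : Graph m} {H : Graph n} →
                   IsCograph G → IsCograph H → IsCograph (disjointUnion G H)
  graph-join     : ∀ {m n} {G : Graph m} {H : Graph n} →
                   IsCograph G → IsCograph H → IsCograph (join G H)
  isomorphic     : ∀ {m n} {G : Graph m} {H : Graph n} →
                   G ≅ H → IsCograph G → IsCograph H

data Player : Set where
  dominator staller : Player

-- `nothing` marks a vertex that nobody has chosen yet.
Position : ℕ → Set
Position n = Vec (Maybe Player) n

start : ∀ n → Position n
start n = replicate n nothing

Unchosen : ∀ {n} → Position n → Pred (Fin n) 0ℓ
Unchosen s v = lookup s v ≡ nothing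

ChosenBy : ∀ {n} → Player → Position n → Pred (Fin n) 0ℓ
ChosenBy p s v = lookup s v ≡ just p

module _ {n : ℕ} (G : Graph n) where

  N[_] : Fin n → Pred (Fin n) 0ℓ
  N[ x ] y = y ≡ x ⊎ Adj G x y

  IsDominating : Pred (Fin n) 0ℓ → Set
  IsDominating S = ∀ x → ∃ λ u → S u × N[ u ] x

  record PairingDominatingSet : Set where
    field
      k        : ℕ
      u v      : Fin k → Fin n
      distinct : Injective _≡_ _≡_ [ u , v ]′
      covers   : Universal (⋃ (Fin k) λ i → N[ u i ] ∩ N[ v i ])

  -- `WinningStrategy p s` is the type of winning strategies for Dominator from
  -- position s with player p to move, presented as trees: Dominator's nodes
  -- carry his chosen move, Staller's nodes branch over all her legal moves.
  -- Requiring some unchosen vertex in `staller-moves` keeps that node from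
  -- holding vacuously once the game is over.
  data WinningStrategy : Player → Position n → Set where
    game-over       : ∀ {p s} → (∀ v → ¬ Unchosen s v) →
                      IsDominating (ChosenBy dominator s) →
                      WinningStrategy p s
    dominator-moves : ∀ {s} v → Unchosen s v →
                      WinningStrategy staller (s [ v ]≔ just dominator) →
                      WinningStrategy dominator s
    staller-moves   : ∀ {s} → ∃ (Unchosen s) →
                      (∀ v → Unchosen s v →
                        WinningStrategy dominator (s [ v ]≔ just staller)) →
                      WinningStrategy staller s

  Outcome𝒟 : Set
  Outcome𝒟 = WinningStrategy dominator (start n) × WinningStrategy staller (start n)

{-# OPTIONS --safe #-}

-- A pairing yields a strategy in every graph. For the converse, consider families of
-- pairs together with additional single vertices, the centres (all vertices distinct),
-- such that every vertex lies in N[u] ∩ N[v] for some pair (u , v) or in N[c] for some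
-- centre c. By induction on cographs, a win for Dominator as second player yields such
-- a family without centres, and a win as first player one with a single centre:
--  * a win in a disjoint union restricts to both parts;
--  * in a join of two graphs with at least two vertices each, one pair on either
--    side suffices;
--  * in a join of one vertex x with H, Staller opens at x, so that Dominator has to
--    win first on H, and x is then paired with the centre obtained for H.
module Submission where

open import Defs
import Data.Fin as Fin
import Data.Sum as Sum
open import Data.Fin using (Fin; zero; suc; splitAt; _↑ˡ_; _↑ʳ_)
open import Data.Fin.Properties using (_≟_; any?; suc-injective; +↔⊎; splitAt-↑ˡ; splitAt-↑ʳ; splitAt-join; join-splitAt; splitAt⁻¹-↑ˡ; splitAt⁻¹-↑ʳ; ↑ˡ-injective; ↑ʳ-injective)
open import Data.Maybe using (Maybe; just; nothing)
open import Data.Nat using (ℕ; zero; suc; _+_; _<_; s≤s)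
open import Data.Nat.Induction using (<-wellFounded)
open import Data.Nat.Properties using (n<1+n; <-trans)
open import Data.Product using (_×_; ∃; _,_)
open import Data.Sum using (_⊎_; inj₁; inj₂; [_,_]′; swap)
open import Data.Sum.Properties using (swap-involutive; inj₁-injective; inj₂-injective) renaming (≡-dec to ⊎-≡-dec)
open import Data.Unit using (tt)
open import Data.Vec using ([]; _∷_; lookup; _[_]≔_)
open import Data.Vec.Properties using (lookup∘update; lookup∘update′; lookup-replicate)
open import Function.Base using (_∘_; id; case_of_)
open import Function.Bundles using (_⇔_; _↔_; mk⇔; mk↔ₛ′; Inverse; Equivalence)
open import Function.Definitions using (Injective)
open import Induction.WellFounded using (Acc; acc)
open import Relation.Binary.PropositionalEquality using (_≡_; _≢_; refl; trans; cong; subst; subst₂) renaming (sym to ≡-sym)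
open import Relation.Nullary using (¬_; yes; no; contradiction; _×-dec_)
open import Relation.Unary using (Decidable)

private variable
  m n : ℕ
  p : Player

-- Positions

unchosen≢chosen : {v : Maybe Player} → v ≡ nothing → v ≢ just p
unchosen≢chosen refl ()

staller≢dominator : {v : Maybe Player} → v ≡ just staller → v ≢ just dominator
staller≢dominator refl ()

unchosen? : (s : Position n) → Decidable (Unchosen s)
unchosen? s v with lookup s v
... | nothing = yes refl
... | just _  = no λ ()

unchosen-start : (v : Fin n) → Unchosen (start n) v
unchosen-start v = lookup-replicate v nothing

Extends : Position n → Position n → Set
Extends s s′ = ∀ v p → ChosenBy p s v → ChosenBy p s′ v

extends-update : (s : Position n) (v : Fin n) → Unchosen s v → ∀ p → Extends s (s [ v ]≔ just p)
extends-update s v free p w q w∈q =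
  trans (lookup∘update′ (λ { refl → unchosen≢chosen free w∈q }) s (just p)) w∈q

-- Measure for the recursion in `play`: a move of each player lowers it by two.
unchosenCount : Position n → ℕ
unchosenCount []            = 0
unchosenCount (nothing ∷ s) = suc (unchosenCount s)
unchosenCount (just _  ∷ s) = unchosenCount s

unchosenCount-update : (s : Position n) (v : Fin n) → Unchosen s v → ∀ p →
                       unchosenCount (s [ v ]≔ just p) < unchosenCount s
unchosenCount-update (nothing ∷ s) zero    _    p = n<1+n _
unchosenCount-update (nothing ∷ s) (suc v) free p = s≤s (unchosenCount-update s v free p)
unchosenCount-update (just _  ∷ s) (suc v) free p = unchosenCount-update s v free p

-- One branch of the strategy tree is followed to its leaf, Staller taking the vertex that
-- `staller-moves` supplies. Since chosen vertices keep their owner, whatever is Staller's in `s`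
-- cannot be among the dominating vertices at the end.
final-position : {G : Graph n} {s : Position n} → WinningStrategy G p s →
                 ∃ λ s′ → Extends s s′ × IsDominating G (ChosenBy dominator s′)
final-position {s = s} (game-over _ dominating) = s , (λ _ _ → id) , dominating
final-position {s = s} (dominator-moves v free σ) =
  let s′ , extends , dominating = final-position σ
  in s′ , (λ w p → extends w p ∘ extends-update s v free dominator w p) , dominating
final-position {s = s} (staller-moves (v , free) σ) =
  let s′ , extends , dominating = final-position (σ v free)
  in s′ , (λ w p → extends w p ∘ extends-update s v free staller w p) , dominating

-- Transfer of winning strategies

-- Dominator imitates on G a strategy for H along f : G → H. Moves of that strategy
-- that have no counterpart on G are replaced by arbitrary ones, which is why t may
-- hold more of his vertices than s does.
module Transfer (G : Graph m) (H : Graph n) {f : Fin m → Fin n} (f-injective : Injective _≡_ _≡_ f) where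

  -- Ensures that domination in H of an image vertex can be pulled back to G: the vertex of H
  -- responsible is either lost to Staller already or comes from a closed neighbour in G.
  Local : Position n → Set
  Local s = ∀ x u → N[_] H u (f x) → ChosenBy staller s u ⊎ ∃ λ u′ → u ≡ f u′ × N[_] G u′ x

  infix 4 _≼_
  _≼_ : Position n → Position m → Set
  s ≼ t = ∀ x → lookup t x ≡ lookup s (f x) ⊎ ChosenBy dominator t x

  local-update : ∀ s w → Unchosen s w → ∀ p → Local s → Local (s [ w ]≔ just p)
  local-update s w free p local x u u∼x with local x u u∼x
  ... | inj₁ u∈S   = inj₁ (extends-update s w free p u staller u∈S)
  ... | inj₂ image = inj₂ image

  ≼-update : ∀ s t v a → s ≼ t → s [ f v ]≔ a ≼ t [ v ]≔ a
  ≼-update s t v a s≼t x with x ≟ v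
  ... | yes refl = inj₁ (trans (lookup∘update v t a) (≡-sym (lookup∘update (f v) s a)))
  ... | no x≢v with s≼t x
  ...   | inj₁ eq  = inj₁ (trans (lookup∘update′ x≢v t a)
                          (trans eq (≡-sym (lookup∘update′ (x≢v ∘ f-injective) s a))))
  ...   | inj₂ x∈D = inj₂ (trans (lookup∘update′ x≢v t a) x∈D)

  ≼-updateʳ : ∀ s t v → s ≼ t → s ≼ t [ v ]≔ just dominator
  ≼-updateʳ s t v s≼t x with x ≟ v
  ... | yes refl = inj₂ (lookup∘update v t (just dominator))
  ... | no x≢v with s≼t x
  ...   | inj₁ eq  = inj₁ (trans (lookup∘update′ x≢v t (just dominator)) eq)
  ...   | inj₂ x∈D = inj₂ (trans (lookup∘update′ x≢v t (just dominator)) x∈D)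

  -- If `t` agreed with `s` at a preimage of `w`, that preimage would be unchosen, against `absent`.
  -- So a preimage of `w`, if any, was taken by Dominator with an earlier extra move.
  ≼-updateˡ : ∀ s t w a → Unchosen s w → ¬ (∃ λ x → f x ≡ w × Unchosen t x) →
              s ≼ t → s [ w ]≔ a ≼ t
  ≼-updateˡ s t w a free absent s≼t x with f x ≟ w | s≼t x
  ... | _        | inj₂ x∈D = inj₂ x∈D
  ... | yes refl | inj₁ eq  = contradiction (x , refl , trans eq free) absent
  ... | no fx≢w  | inj₁ eq  = inj₁ (trans eq (≡-sym (lookup∘update′ fx≢w s a)))

  unchosen-≼ : ∀ s t v → Unchosen t v → s ≼ t → Unchosen s (f v)
  unchosen-≼ s t v free s≼t with s≼t v
  ... | inj₁ eq  = trans (≡-sym eq) free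
  ... | inj₂ v∈D = contradiction v∈D (unchosen≢chosen free)

  -- The board of H may still be open, so its game is first played out by `final-position`. The
  -- vertex that then dominates `f x` is not Staller's in `s`, hence `Local` makes it an image
  -- `f u′`. As `t` is full, `u′` has an owner; if that were Staller, she would own `f u′` in `s` as
  -- well.
  dominating-≼ : ∀ {s} t → WinningStrategy H p s → Local s → s ≼ t → ¬ ∃ (Unchosen t) →
                 IsDominating G (ChosenBy dominator t)
  dominating-≼ {s = s} t σ local s≼t full x
    with final-position σ
  ... | s′ , extends , dominating with dominating (f x)
  ...   | u , u∈D , u∼fx with local x u u∼fx
  ...     | inj₁ u∈S = contradiction u∈D (staller≢dominator (extends u staller u∈S))
  ...     | inj₂ (u′ , refl , u′∼x) = u′ , u′∈D (lookup t u′) refl (s≼t u′) , u′∼x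
    where
    u′∈D : ∀ a → lookup t u′ ≡ a → lookup t u′ ≡ lookup s (f u′) ⊎ ChosenBy dominator t u′ →
           ChosenBy dominator t u′
    u′∈D _ _ (inj₂ ∈D) = ∈D
    u′∈D nothing          eq _ = contradiction (u′ , eq) full
    u′∈D (just dominator) eq _ = eq
    u′∈D (just staller)   eq (inj₁ agree) =
      contradiction u∈D (staller≢dominator (extends (f u′) staller (trans (≡-sym agree) eq)))

  game-over-≼ : ∀ {q s} t → WinningStrategy H p s → Local s → s ≼ t → ¬ ∃ (Unchosen t) →
                WinningStrategy G q t
  game-over-≼ t σ local s≼t full =
    game-over (λ v free → full (v , free)) (dominating-≼ t σ local s≼t full)

  transfer : ∀ {s t} → WinningStrategy H p s → Local s → s ≼ t → WinningStrategy G p t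
  -- Dominator has already moved in H but still owes a move in G: he takes any unchosen vertex,
  -- after which Staller is to move on both boards.
  transfer-tempo : ∀ {s t} → WinningStrategy H staller s → Local s → s ≼ t →
                   WinningStrategy G dominator t

  transfer {t = t} σ local s≼t with any? (unchosen? t)
  transfer {t = t} σ local s≼t | no full = game-over-≼ t σ local s≼t full
  transfer {s = s} {t} (game-over full _) local s≼t | yes (v , free) =
    contradiction (unchosen-≼ s t v free s≼t) (full (f v))
  transfer {s = s} {t} (staller-moves _ σ) local s≼t | yes open-vertex =
    staller-moves open-vertex λ v free →
      let free′ = unchosen-≼ s t v free s≼t
      in transfer (σ (f v) free′)
                  (local-update s (f v) free′ staller local)
                  (≼-update s t v (just staller) s≼t)
  transfer {s = s} {t} (dominator-moves w free σ) local s≼t | yes _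
    with any? (λ x → f x ≟ w ×-dec unchosen? t x)
  ... | yes (v , refl , free′) =
    dominator-moves v free′
      (transfer σ (local-update s w free dominator local)
                  (≼-update s t v (just dominator) s≼t))
  ... | no absent =
    transfer-tempo σ (local-update s w free dominator local)
                     (≼-updateˡ s t w (just dominator) free absent s≼t)

  transfer-tempo {s = s} {t} σ local s≼t with any? (unchosen? t)
  ... | no full        = game-over-≼ t σ local s≼t full
  ... | yes (v , free) = dominator-moves v free (transfer σ local (≼-updateʳ s t v s≼t))

-- An extra vertex never harms Dominator: he opens anywhere and then imitates his second-player
-- strategy along the identity map.
second⇒first : (G : Graph n) → WinningStrategy G staller (start n) → WinningStrategy G dominator (start n)
second⇒first G σ =
  transfer-tempo σ (λ _ u u∼x → inj₂ (u , refl , u∼x)) (λ _ → inj₁ refl)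
  where open Transfer G G {f = id} id

-- The pairing strategy

module PairingStrategy {G : Graph n} (P : PairingDominatingSet G) where
  open PairingDominatingSet P

  End : Set
  End = Fin k ⊎ Fin k

  at : End → Fin n
  at = [ u , v ]′

  -- The invariant when Staller is to move: Dominator holds an end of the pair or both ends are
  -- unchosen. Stating it for ends, with `swap` giving the partner, treats the two sides of a pair
  -- alike.
  data Safe (s : Position n) (e : End) : Set where
    own       : ChosenBy dominator s (at e) → Safe s e
    partner   : ChosenBy dominator s (at (swap e)) → Safe s e
    untouched : Unchosen s (at e) → Unchosen s (at (swap e)) → Safe s e

  safe-unaffected : ∀ {s e} w a → at e ≢ w → at (swap e) ≢ w → Safe s e → Safe (s [ w ]≔ a) e
  safe-unaffected {s} {e} w a e≢w e′≢w = λ where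
    (own ∈D)               → own (trans (lookup∘update′ e≢w s a) ∈D)
    (partner ∈D)           → partner (trans (lookup∘update′ e′≢w s a) ∈D)
    (untouched free free′) → untouched (trans (lookup∘update′ e≢w s a) free)
                                       (trans (lookup∘update′ e′≢w s a) free′)

  safe-dominator : ∀ {s} w → (∀ e → Safe s e) → ∀ e → Safe (s [ w ]≔ just dominator) e
  safe-dominator {s} w safe e with at e ≟ w | at (swap e) ≟ w
  ... | yes refl | _        = own (lookup∘update w s _)
  ... | no _     | yes refl = partner (lookup∘update w s _)
  ... | no e≢w   | no e′≢w  = safe-unaffected w _ e≢w e′≢w (safe e)

  at-≢ : ∀ {e e′} → e ≢ e′ → at e ≢ at e′
  at-≢ e≢e′ = e≢e′ ∘ distinct

  swap-≢ : ∀ {e e′ : End} → e ≢ swap e′ → swap e ≢ e′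
  swap-≢ {e} e≢ refl = e≢ (≡-sym (swap-involutive e))

  swap-fixed-free : (e : End) → swap e ≢ e
  swap-fixed-free (inj₁ _) ()
  swap-fixed-free (inj₂ _) ()

  safe-repaired : ∀ {s} e → ChosenBy dominator s (at (swap e)) →
                  (∀ e′ → e′ ≢ e → e′ ≢ swap e → Safe s e′) → ∀ e′ → Safe s e′
  safe-repaired e ∈D others e′ with ⊎-≡-dec _≟_ _≟_ e′ e | ⊎-≡-dec _≟_ _≟_ e′ (swap e)
  ... | yes refl | _        = partner ∈D
  ... | no _     | yes refl = own ∈D
  ... | no e′≢e  | no e′≢   = others e′ e′≢e e′≢

  others-unaffected : ∀ {s} e a → (∀ e′ → Safe s e′) → ∀ e′ → e′ ≢ e → e′ ≢ swap e →
                      Safe (s [ at e ]≔ a) e′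
  others-unaffected e a safe e′ e′≢e e′≢ =
    safe-unaffected (at e) a (at-≢ e′≢e) (at-≢ (swap-≢ e′≢)) (safe e′)

  -- Either the invariant has survived Staller's move, leaving Dominator free to play anywhere, or
  -- the vertex `y` restores it.
  Reply : Position n → Set
  Reply s = (∀ e → Safe s e) ⊎
            ∃ λ y → Unchosen s y × ∀ e → Safe (s [ y ]≔ just dominator) e

  reply : ∀ {s} x → Unchosen s x → (∀ e → Safe s e) → Reply (s [ x ]≔ just staller)
  reply-at : ∀ {s} e → Unchosen s (at e) → (∀ e → Safe s e) → Reply (s [ at e ]≔ just staller)

  reply {s} x free safe with any? (λ i → x ≟ u i) | any? (λ i → x ≟ v i)
  ... | yes (i , refl) | _              = reply-at (inj₁ i) free safe
  ... | no _           | yes (i , refl) = reply-at (inj₂ i) free safe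
  ... | no x∉u         | no x∉v         = inj₁ λ e →
    safe-unaffected x _ (x≢at e) (x≢at (swap e)) (safe e)
    where
    x≢at : ∀ e → at e ≢ x
    x≢at (inj₁ i) eq = x∉u (i , ≡-sym eq)
    x≢at (inj₂ i) eq = x∉v (i , ≡-sym eq)

  reply-at {s} e free safe with unchosen? s (at (swap e))
  ... | yes free′ = inj₂ (at (swap e) , trans (lookup∘update′ partner≢ s _) free′ ,
      safe-repaired e (lookup∘update (at (swap e)) (s [ at e ]≔ just staller) _) λ e′ e′≢e e′≢ →
        safe-unaffected (at (swap e)) _ (at-≢ e′≢) (at-≢ (e′≢e ∘ swap-injective))
          (others-unaffected e _ safe e′ e′≢e e′≢))
    where
    partner≢ : at (swap e) ≢ at e
    partner≢ = at-≢ (swap-fixed-free e)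
    swap-injective : ∀ {e e′ : End} → swap e ≡ swap e′ → e ≡ e′
    swap-injective {e} {e′} eq =
      trans (≡-sym (swap-involutive e)) (trans (cong swap eq) (swap-involutive e′))
  -- Before Staller's move `at e` was unchosen and its partner was not, so safety of `e` can only
  -- mean that Dominator holds the partner.
  ... | no taken = inj₁ (safe-repaired e
      (trans (lookup∘update′ (at-≢ (swap-fixed-free e)) s _) (partner∈D (safe e)))
      (others-unaffected e _ safe))
    where
    partner∈D : Safe s e → ChosenBy dominator s (at (swap e))
    partner∈D (own ∈D)            = contradiction ∈D (unchosen≢chosen free)
    partner∈D (partner ∈D)        = ∈D
    partner∈D (untouched _ free′) = contradiction free′ taken

  -- On a full board no pair is untouched, so Dominator holds an end of each; a vertex covered by a
  -- pair is in the closed neighbourhood of both ends, whichever of them he holds.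
  safe-full : ∀ {s} → (∀ e → Safe s e) → ¬ ∃ (Unchosen s) → WinningStrategy G p s
  safe-full {s = s} safe full = game-over (λ v free → full (v , free)) dominating
    where
    dominating : IsDominating G (ChosenBy dominator s)
    dominating x with covers x
    ... | i , x∼u , x∼v with safe (inj₁ i)
    ...   | own u∈D          = u i , u∈D , x∼u
    ...   | partner v∈D      = v i , v∈D , x∼v
    ...   | untouched free _ = contradiction (u i , free) full

  play : ∀ s → Acc _<_ (unchosenCount s) → (∀ e → Safe s e) → WinningStrategy G staller s
  play s (acc rec) safe with any? (unchosen? s)
  ... | no full = safe-full safe full
  ... | yes open-vertex = staller-moves open-vertex λ x free → respond x free (reply x free safe)
    where
    respond : ∀ x → Unchosen s x → Reply (s [ x ]≔ just staller) →
              WinningStrategy G dominator (s [ x ]≔ just staller)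
    respond-at : ∀ x → Unchosen s x → ∀ y → Unchosen (s [ x ]≔ just staller) y →
                 (∀ e → Safe (s [ x ]≔ just staller [ y ]≔ just dominator) e) →
                 WinningStrategy G dominator (s [ x ]≔ just staller)

    respond x free (inj₂ (y , free′ , safe′)) = respond-at x free y free′ safe′
    -- Staller may have taken the last vertex. Otherwise Dominator must move, as there is no
    -- passing, and any vertex keeps the invariant.
    respond x free (inj₁ safe′) with any? (unchosen? (s [ x ]≔ just staller))
    ... | no full         = safe-full safe′ full
    ... | yes (y , free′) = respond-at x free y free′ (safe-dominator y safe′)

    respond-at x free y free′ safe′ =
      dominator-moves y free′ (play _ (rec fewer) safe′)
      where
      fewer : unchosenCount (s [ x ]≔ just staller [ y ]≔ just dominator) < unchosenCount s
      fewer = <-trans (unchosenCount-update (s [ x ]≔ just staller) y free′ dominator)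
                      (unchosenCount-update s x free staller)

  wins-second : WinningStrategy G staller (start n)
  wins-second = play (start n) (<-wellFounded _)
    λ e → untouched (unchosen-start (at e)) (unchosen-start (at (swap e)))

-- Pairings with centres

private variable
  C D I J : Set

-- One slot per centre and two per pair. The index types are arbitrary, so that families on two
-- graphs combine by sums of types; `reindex` then returns to `Fin`.
Slots : Set → Set → Set
Slots C I = C ⊎ (I ⊎ I)

pattern centre c = inj₁ c
pattern left i   = inj₂ (inj₁ i)
pattern right i  = inj₂ (inj₂ i)

Covered : Graph n → (Slots C I → Fin n) → Fin n → Set
Covered G at x = (∃ λ c → N[_] G (at (centre c)) x) ⊎
                 (∃ λ i → N[_] G (at (left i)) x × N[_] G (at (right i)) x)

record Pairing (C I : Set) (G : Graph n) : Set where
  field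
    at       : Slots C I → Fin n
    distinct : Injective _≡_ _≡_ at
    covers   : ∀ x → Covered G at x

open Pairing

Paired : ℕ → Graph n → Set
Paired a G = ∃ λ k → Pairing (Fin a) (Fin k) G

injective-by-retraction : {A B : Set} {f : A → B} (g : B → A) → (∀ x → g (f x) ≡ x) → Injective _≡_ _≡_ f
injective-by-retraction g g∘f {x} {y} eq =
  trans (≡-sym (g∘f x)) (trans (cong g eq) (g∘f y))

reindex : {G : Graph n} → D ↔ C → J ↔ I → Pairing C I G → Pairing D J G
reindex {D = D} {C = C} {J = J} {I = I} {G = G} D↔C J↔I P = record
  { at = at P ∘ to
  ; distinct = injective-by-retraction from from∘to ∘ distinct P
  ; covers = covers′
  }
  where
  module C = Inverse D↔C
  module I = Inverse J↔I
  to : Slots D J → Slots C I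
  to = Sum.map C.to (Sum.map I.to I.to)
  from : Slots C I → Slots D J
  from = Sum.map C.from (Sum.map I.from I.from)
  from∘to : ∀ e → from (to e) ≡ e
  from∘to (centre c) = cong inj₁ (C.strictlyInverseʳ c)
  from∘to (left i)   = cong (inj₂ ∘ inj₁) (I.strictlyInverseʳ i)
  from∘to (right i)  = cong (inj₂ ∘ inj₂) (I.strictlyInverseʳ i)
  covers′ : ∀ x → Covered G (at P ∘ to) x
  covers′ x with covers P x
  ... | inj₁ (c , c∼x) =
    inj₁ (C.from c , subst (λ c → N[_] G (at P (centre c)) x) (≡-sym (C.strictlyInverseˡ c)) c∼x)
  ... | inj₂ (i , i∼x) =
    inj₂ (I.from i , subst (λ i → N[_] G (at P (left i)) x × N[_] G (at P (right i)) x)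
                           (≡-sym (I.strictlyInverseˡ i)) i∼x)

pairingDominatingSet : {G : Graph n} → Paired 0 G → PairingDominatingSet G
pairingDominatingSet {G = G} (k , P) = record
  { k = k
  ; u = at P ∘ inj₂ ∘ inj₁
  ; v = at P ∘ inj₂ ∘ inj₂
  ; distinct = λ {e} {e′} eq → inj₂-injective (distinct P (trans (merge e) (trans eq (≡-sym (merge e′)))))
  ; covers = λ x → case covers P x of λ where (inj₂ pair) → pair
  }
  where
  -- The two sides agree by computation only once `e` is split.
  merge : ∀ e → at P (inj₂ e) ≡ [ at P ∘ inj₂ ∘ inj₁ , at P ∘ inj₂ ∘ inj₂ ]′ e
  merge (inj₁ _) = refl
  merge (inj₂ _) = refl

universal-paired : {G : Graph n} (x : Fin n) → (∀ y → N[_] G x y) → Paired 1 G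
universal-paired {n = n} x dominates = 0 , record
  { at = constant
  ; distinct = constant-injective
  ; covers = λ y → inj₁ (zero , dominates y)
  }
  where
  constant : Slots (Fin 1) (Fin 0) → Fin n
  constant _ = x
  constant-injective : Injective _≡_ _≡_ constant
  constant-injective {centre zero} {centre zero} _ = refl
  constant-injective {centre _} {left ()}
  constant-injective {centre _} {right ()}
  constant-injective {left ()}
  constant-injective {right ()}

-- Since N[u] ∩ N[v] lies in N[u], the first pair can be weakened to the centre u and v dropped. A
-- first pair exists because the vertex `x` has to be covered.
promote : {G : Graph n} → Fin n → Paired 0 G → Paired 1 G
promote x (zero , P) with covers P x
... | inj₁ (() , _)
... | inj₂ (() , _)
promote {G = G} _ (suc k , P) = k , record
  { at = at P ∘ h
  ; distinct = injective-by-retraction h⁻¹ h⁻¹∘h ∘ distinct P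
  ; covers = covers′
  }
  where
  h : Slots (Fin 1) (Fin k) → Slots (Fin 0) (Fin (suc k))
  h (centre _) = left zero
  h (left i)   = left (suc i)
  h (right i)  = right (suc i)
  -- h misses right zero, where the value of h⁻¹ is irrelevant.
  h⁻¹ : Slots (Fin 0) (Fin (suc k)) → Slots (Fin 1) (Fin k)
  h⁻¹ (left zero)     = centre zero
  h⁻¹ (left (suc i))  = left i
  h⁻¹ (right zero)    = centre zero
  h⁻¹ (right (suc i)) = right i
  h⁻¹∘h : ∀ e → h⁻¹ (h e) ≡ e
  h⁻¹∘h (centre zero) = refl
  h⁻¹∘h (left _)      = refl
  h⁻¹∘h (right _)     = refl
  covers′ : ∀ x → Covered G (at P ∘ h) x
  covers′ x with covers P x
  ... | inj₂ (zero  , x∼u , _) = inj₁ (zero , x∼u)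
  ... | inj₂ (suc i , pair)    = inj₂ (i , pair)

↑-elim : (P : Fin (m + n) → Set) → (∀ x → P (x ↑ˡ n)) → (∀ x → P (m ↑ʳ x)) → ∀ x → P x
↑-elim {m} {n} P l r x = subst P (join-splitAt m n x) (onJoin (splitAt m x))
  where
  onJoin : ∀ y → P (Fin.join m n y)
  onJoin (inj₁ y) = l y
  onJoin (inj₂ y) = r y

slots-⊎ : Slots (C ⊎ D) (I ⊎ J) → Slots C I ⊎ Slots D J
slots-⊎ (centre (inj₁ c)) = inj₁ (centre c)
slots-⊎ (centre (inj₂ d)) = inj₂ (centre d)
slots-⊎ (left (inj₁ i))   = inj₁ (left i)
slots-⊎ (left (inj₂ j))   = inj₂ (left j)
slots-⊎ (right (inj₁ i))  = inj₁ (right i)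
slots-⊎ (right (inj₂ j))  = inj₂ (right j)

slots-⊎⁻¹ : Slots C I ⊎ Slots D J → Slots (C ⊎ D) (I ⊎ J)
slots-⊎⁻¹ = [ Sum.map inj₁ (Sum.map inj₁ inj₁) , Sum.map inj₂ (Sum.map inj₂ inj₂) ]′

slots-⊎-inverse : (e : Slots (C ⊎ D) (I ⊎ J)) → slots-⊎⁻¹ (slots-⊎ e) ≡ e
slots-⊎-inverse (centre (inj₁ _)) = refl
slots-⊎-inverse (centre (inj₂ _)) = refl
slots-⊎-inverse (left (inj₁ _))   = refl
slots-⊎-inverse (left (inj₂ _))   = refl
slots-⊎-inverse (right (inj₁ _))  = refl
slots-⊎-inverse (right (inj₂ _))  = refl

_⊕_ : (Slots C I → Fin m) → (Slots D J → Fin n) → Slots (C ⊎ D) (I ⊎ J) → Fin (m + n)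
_⊕_ {m = m} {n = n} f g = Fin.join m n ∘ Sum.map f g ∘ slots-⊎

⊕-injective : {f : Slots C I → Fin m} {g : Slots D J → Fin n} →
              Injective _≡_ _≡_ f → Injective _≡_ _≡_ g → Injective _≡_ _≡_ (f ⊕ g)
⊕-injective {m = m} {n = n} {f = f} {g = g} f-inj g-inj =
  injective-by-retraction {f = slots-⊎} slots-⊎⁻¹ slots-⊎-inverse ∘ map-injective ∘
  injective-by-retraction {f = Fin.join m n} (splitAt m) (splitAt-join m n)
  where
  map-injective : Injective _≡_ _≡_ (Sum.map f g)
  map-injective {inj₁ _} {inj₁ _} eq = cong inj₁ (f-inj (inj₁-injective eq))
  map-injective {inj₂ _} {inj₂ _} eq = cong inj₂ (g-inj (inj₂-injective eq))

-- Isomorphisms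

module _ {G : Graph m} {H : Graph n} (iso : G ≅ H) where
  open _≅_ iso
  open Inverse bijection

  ≅-closed-nbhd : ∀ {u x} → N[_] G u x → N[_] H (to u) (to x)
  ≅-closed-nbhd (inj₁ refl) = inj₁ refl
  ≅-closed-nbhd (inj₂ adj)  = inj₂ (Equivalence.to (preserves _ _) adj)

  ≅-closed-nbhd⁻¹ : ∀ {u x} → N[_] H (to u) (to x) → N[_] G u x
  ≅-closed-nbhd⁻¹ (inj₁ eq)  = inj₁ (injective-by-retraction from strictlyInverseʳ eq)
  ≅-closed-nbhd⁻¹ (inj₂ adj) = inj₂ (Equivalence.from (preserves _ _) adj)

  ≅-strategy : WinningStrategy H p (start n) → WinningStrategy G p (start m)
  ≅-strategy σ = transfer σ local
      (λ x → inj₁ (trans (unchosen-start x) (≡-sym (unchosen-start (to x)))))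
    where
    open Transfer G H (injective-by-retraction from strictlyInverseʳ)
    local : Local (start n)
    local x u u∼x = inj₂ (from u , ≡-sym (strictlyInverseˡ u) ,
      ≅-closed-nbhd⁻¹ (subst (λ u → N[_] H u (to x)) (≡-sym (strictlyInverseˡ u)) u∼x))

  ≅-paired : ∀ {a} → Paired a G → Paired a H
  ≅-paired (k , P) = k , record
    { at = to ∘ at P
    ; distinct = distinct P ∘ injective-by-retraction from strictlyInverseʳ
    ; covers = λ x → subst (Covered H (to ∘ at P)) (strictlyInverseˡ x) (covers′ (from x))
    }
    where
    covers′ : ∀ x → Covered H (to ∘ at P) (to x)
    covers′ x with covers P x
    ... | inj₁ (c , c∼x)         = inj₁ (c , ≅-closed-nbhd c∼x)
    ... | inj₂ (i , u∼x , v∼x)   = inj₂ (i , ≅-closed-nbhd u∼x , ≅-closed-nbhd v∼x)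

-- Allows a one-vertex graph on the right of a join to be handled as one on the left.
join-comm : (G : Graph m) (H : Graph n) → join G H ≅ join H G
join-comm {m} {n} G H = record
  { bijection = mk↔ₛ′ (σ m n) (σ n m) (σ-involutive n m) (σ-involutive m n)
  ; preserves = λ u v → mk⇔
      (subst₂ (JoinAdj H G) (≡-sym (splitAt-σ u)) (≡-sym (splitAt-σ v)) ∘ swapAdj (splitAt m u) (splitAt m v))
      (unswapAdj (splitAt m u) (splitAt m v) ∘ subst₂ (JoinAdj H G) (splitAt-σ u) (splitAt-σ v))
  }
  where
  σ : ∀ m n → Fin (m + n) → Fin (n + m)
  σ m n = Fin.join n m ∘ swap ∘ splitAt m
  σ-involutive : ∀ m n x → σ n m (σ m n x) ≡ x
  σ-involutive m n x = trans
    (cong (Fin.join m n ∘ swap) (splitAt-join n m (swap (splitAt m x))))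
    (trans (cong (Fin.join m n) (swap-involutive (splitAt m x))) (join-splitAt m n x))
  splitAt-σ : ∀ x → splitAt n (σ m n x) ≡ swap (splitAt m x)
  splitAt-σ x = splitAt-join n m (swap (splitAt m x))
  swapAdj : ∀ x y → JoinAdj G H x y → JoinAdj H G (swap x) (swap y)
  swapAdj (inj₁ _) (inj₁ _) = id
  swapAdj (inj₁ _) (inj₂ _) = id
  swapAdj (inj₂ _) (inj₁ _) = id
  swapAdj (inj₂ _) (inj₂ _) = id
  unswapAdj : ∀ x y → JoinAdj H G (swap x) (swap y) → JoinAdj G H x y
  unswapAdj (inj₁ _) (inj₁ _) = id
  unswapAdj (inj₁ _) (inj₂ _) = id
  unswapAdj (inj₂ _) (inj₁ _) = id
  unswapAdj (inj₂ _) (inj₂ _) = id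

-- Disjoint unions

module _ (G : Graph m) (H : Graph n) where

  private
    U : Graph (m + n)
    U = disjointUnion G H

  union-nbhdˡ : ∀ {u x} → N[_] G u x → N[_] U (u ↑ˡ n) (x ↑ˡ n)
  union-nbhdˡ (inj₁ refl) = inj₁ refl
  union-nbhdˡ {u} {x} (inj₂ adj) = inj₂
    (subst₂ (UnionAdj G H) (≡-sym (splitAt-↑ˡ m u n)) (≡-sym (splitAt-↑ˡ m x n)) adj)

  union-nbhdʳ : ∀ {u x} → N[_] H u x → N[_] U (m ↑ʳ u) (m ↑ʳ x)
  union-nbhdʳ (inj₁ refl) = inj₁ refl
  union-nbhdʳ {u} {x} (inj₂ adj) = inj₂
    (subst₂ (UnionAdj G H) (≡-sym (splitAt-↑ʳ m n u)) (≡-sym (splitAt-↑ʳ m n x)) adj)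

  union-nbhdˡ⁻¹ : ∀ x u → N[_] U u (x ↑ˡ n) → ∃ λ u′ → u ≡ u′ ↑ˡ n × N[_] G u′ x
  union-nbhdˡ⁻¹ x u (inj₁ refl) = x , refl , inj₁ refl
  union-nbhdˡ⁻¹ x u (inj₂ adj)
    with splitAt m u in eq | subst (UnionAdj G H (splitAt m u)) (splitAt-↑ˡ m x n) adj
  ... | inj₁ u′ | adj′ = u′ , ≡-sym (splitAt⁻¹-↑ˡ eq) , inj₂ adj′

  union-nbhdʳ⁻¹ : ∀ x u → N[_] U u (m ↑ʳ x) → ∃ λ u′ → u ≡ m ↑ʳ u′ × N[_] H u′ x
  union-nbhdʳ⁻¹ x u (inj₁ refl) = x , refl , inj₁ refl
  union-nbhdʳ⁻¹ x u (inj₂ adj)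
    with splitAt m u in eq | subst (UnionAdj G H (splitAt m u)) (splitAt-↑ʳ m n x) adj
  ... | inj₂ u′ | adj′ = u′ , ≡-sym (splitAt⁻¹-↑ʳ eq) , inj₂ adj′

  -- No edge leaves G, so its vertices can be dominated only from within G, and the strategy's moves
  -- in H turn into arbitrary ones. The positions are general because `union-first` also uses this
  -- after an opening move.
  union-strategyˡ : ∀ {s t} → WinningStrategy U p s → (∀ x → lookup t x ≡ lookup s (x ↑ˡ n)) →
                    WinningStrategy G p t
  union-strategyˡ σ agree =
    transfer σ (λ x u u∼x → inj₂ (union-nbhdˡ⁻¹ x u u∼x)) (inj₁ ∘ agree)
    where open Transfer G U (↑ˡ-injective n _ _)

  union-strategyʳ : ∀ {s t} → WinningStrategy U p s → (∀ x → lookup t x ≡ lookup s (m ↑ʳ x)) →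
                    WinningStrategy H p t
  union-strategyʳ σ agree =
    transfer σ (λ x u u∼x → inj₂ (union-nbhdʳ⁻¹ x u u∼x)) (inj₁ ∘ agree)
    where open Transfer H U (↑ʳ-injective m _ _)

  -- Centres add up, so a single centre in just one of the parts leaves a single centre in the
  -- union.
  union-paired : ∀ {a b} → Paired a G → Paired b H → Paired (a + b) U
  union-paired (k , P) (l , Q) = k + l , reindex +↔⊎ +↔⊎ record
    { at = at P ⊕ at Q
    ; distinct = ⊕-injective (distinct P) (distinct Q)
    ; covers = ↑-elim (Covered U (at P ⊕ at Q)) coversˡ coversʳ
    }
    where
    coversˡ : ∀ y → Covered U (at P ⊕ at Q) (y ↑ˡ n)
    coversˡ y with covers P y
    ... | inj₁ (c , c∼y)       = inj₁ (inj₁ c , union-nbhdˡ c∼y)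
    ... | inj₂ (i , u∼y , v∼y) = inj₂ (inj₁ i , union-nbhdˡ u∼y , union-nbhdˡ v∼y)
    coversʳ : ∀ y → Covered U (at P ⊕ at Q) (m ↑ʳ y)
    coversʳ y with covers Q y
    ... | inj₁ (c , c∼y)       = inj₁ (inj₂ c , union-nbhdʳ c∼y)
    ... | inj₂ (i , u∼y , v∼y) = inj₂ (inj₂ i , union-nbhdʳ u∼y , union-nbhdʳ v∼y)

  ↑ˡ≢↑ʳ : ∀ x y → x ↑ˡ n ≢ m ↑ʳ y
  ↑ˡ≢↑ʳ x y eq with trans (≡-sym (splitAt-↑ˡ m x n)) (trans (cong (splitAt m) eq) (splitAt-↑ʳ m n y))
  ... | ()

  union-second : WinningStrategy U staller (start (m + n)) →
                 WinningStrategy G staller (start m) × WinningStrategy H staller (start n)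
  union-second σ =
    union-strategyˡ σ (λ x → trans (unchosen-start x) (≡-sym (unchosen-start (x ↑ˡ n)))) ,
    union-strategyʳ σ (λ x → trans (unchosen-start x) (≡-sym (unchosen-start (m ↑ʳ x))))

  -- The opening move falls into one part, where Dominator has thus moved first; the other part is
  -- untouched and Staller may be the first to play there. The vertex given as argument excludes a
  -- game that is over at the start.
  union-first : Fin m → WinningStrategy U dominator (start (m + n)) →
                (WinningStrategy G dominator (start m) × WinningStrategy H staller (start n)) ⊎
                (WinningStrategy G staller (start m) × WinningStrategy H dominator (start n))
  union-first x (game-over full _) = contradiction (unchosen-start (x ↑ˡ n)) (full (x ↑ˡ n))
  union-first _ (dominator-moves v _ σ) with splitAt m v in eq
  ... | inj₁ w rewrite ≡-sym (splitAt⁻¹-↑ˡ eq) = inj₁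
    ( dominator-moves w (unchosen-start w) (union-strategyˡ σ moved)
    , union-strategyʳ σ λ x → trans (unchosen-start x)
        (≡-sym (trans (lookup∘update′ (↑ˡ≢↑ʳ w x ∘ ≡-sym) (start (m + n)) _) (unchosen-start (m ↑ʳ x)))))
    where
    moved : ∀ x → lookup (start m [ w ]≔ just dominator) x ≡
                  lookup (start (m + n) [ w ↑ˡ n ]≔ just dominator) (x ↑ˡ n)
    moved x with x ≟ w
    ... | yes refl = trans (lookup∘update x (start m) _) (≡-sym (lookup∘update (x ↑ˡ n) (start (m + n)) _))
    ... | no x≢w = trans (trans (lookup∘update′ x≢w (start m) _) (unchosen-start x))
      (≡-sym (trans (lookup∘update′ (x≢w ∘ ↑ˡ-injective n _ _) (start (m + n)) _) (unchosen-start (x ↑ˡ n))))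
  ... | inj₂ w rewrite ≡-sym (splitAt⁻¹-↑ʳ {m} eq) = inj₂
    ( (union-strategyˡ σ λ x → trans (unchosen-start x)
        (≡-sym (trans (lookup∘update′ (↑ˡ≢↑ʳ x w) (start (m + n)) _) (unchosen-start (x ↑ˡ n)))))
    , dominator-moves w (unchosen-start w) (union-strategyʳ σ moved))
    where
    moved : ∀ x → lookup (start n [ w ]≔ just dominator) x ≡
                  lookup (start (m + n) [ m ↑ʳ w ]≔ just dominator) (m ↑ʳ x)
    moved x with x ≟ w
    ... | yes refl = trans (lookup∘update x (start n) _) (≡-sym (lookup∘update (m ↑ʳ x) (start (m + n)) _))
    ... | no x≢w = trans (trans (lookup∘update′ x≢w (start n) _) (unchosen-start x))
      (≡-sym (trans (lookup∘update′ (x≢w ∘ ↑ʳ-injective m _ _) (start (m + n)) _) (unchosen-start (m ↑ʳ x))))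

-- Joins

module _ (G : Graph 1) (H : Graph n) where

  private
    K : Graph (1 + n)
    K = join G H

  -- `splitAt 1` computes on `zero` and `suc`, so adjacency in K reduces to `⊤` between the apex and
  -- H, and to adjacency of H on successors.
  apex-nbhd : ∀ x → N[_] K zero x
  apex-nbhd zero    = inj₁ refl
  apex-nbhd (suc _) = inj₂ tt

  -- Let Staller open at the apex. The apex can then no longer dominate anything for Dominator, who
  -- is to move on what remains, an untouched copy of H.
  apex-second : WinningStrategy K staller (start (1 + n)) → WinningStrategy H dominator (start n)
  apex-second (game-over full _) = contradiction refl (full zero)
  apex-second (staller-moves _ σ) = transfer (σ zero refl) local (λ _ → inj₁ refl)
    where
    open Transfer H K {f = suc} suc-injective
    local : Local (just staller ∷ start n)
    local _ zero    _           = inj₁ refl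
    local x (suc _) (inj₁ refl) = inj₂ (x , refl , inj₁ refl)
    local _ (suc u) (inj₂ adj)  = inj₂ (u , refl , inj₂ adj)

  -- The closed neighbourhood of the apex is everything, so pairing the apex with the centre c
  -- covers all of N[c], and the apex itself.
  apex-pair : Paired 1 H → Paired 0 K
  apex-pair (k , P) = suc k , record
    { at = at′
    ; distinct = λ {e} {e′} → distinct′ e e′
    ; covers = covers′
    }
    where
    at′ : Slots (Fin 0) (Fin (suc k)) → Fin (1 + n)
    at′ (left zero)     = zero
    at′ (left (suc i))  = suc (at P (left i))
    at′ (right zero)    = suc (at P (centre zero))
    at′ (right (suc i)) = suc (at P (right i))

    -- The slot of the new family that receives `at P e`. Every slot except `left zero`, the apex,
    -- arises in this way, so distinctness is inherited from `P`.
    slot : Slots (Fin 1) (Fin k) → Slots (Fin 0) (Fin (suc k))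
    slot (centre _) = right zero
    slot (left i)   = left (suc i)
    slot (right i)  = right (suc i)

    distinct-suc : ∀ {e e′} → Fin.suc (at P e) ≡ suc (at P e′) → slot e ≡ slot e′
    distinct-suc = cong slot ∘ distinct P ∘ suc-injective

    distinct′ : ∀ e e′ → at′ e ≡ at′ e′ → e ≡ e′
    distinct′ (left zero)     (left zero)     _  = refl
    distinct′ (left zero)     (right zero)    ()
    distinct′ (left zero)     (right (suc _)) ()
    distinct′ (left (suc _))  (left (suc _))  eq = distinct-suc eq
    distinct′ (left (suc _))  (right zero)    eq = distinct-suc eq
    distinct′ (left (suc _))  (right (suc _)) eq = distinct-suc eq
    distinct′ (right zero)    (left (suc _))  eq = distinct-suc eq
    distinct′ (right zero)    (right zero)    _  = refl
    distinct′ (right zero)    (right (suc _)) eq = distinct-suc eq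
    distinct′ (right (suc _)) (left (suc _))  eq = distinct-suc eq
    distinct′ (right (suc _)) (right zero)    eq = distinct-suc eq
    distinct′ (right (suc _)) (right (suc _)) eq = distinct-suc eq

    suc-nbhd : ∀ {u x} → N[_] H u x → N[_] K (suc u) (suc x)
    suc-nbhd (inj₁ refl) = inj₁ refl
    suc-nbhd (inj₂ adj)  = inj₂ adj

    covers′ : ∀ x → Covered K at′ x
    covers′ zero = inj₂ (zero , inj₁ refl , inj₂ tt)
    covers′ (suc x) with covers P x
    ... | inj₁ (zero , c∼x)    = inj₂ (zero , inj₂ tt , suc-nbhd c∼x)
    ... | inj₂ (i , u∼x , v∼x) = inj₂ (suc i , suc-nbhd u∼x , suc-nbhd v∼x)

join-paired : (G : Graph (2 + m)) (H : Graph (2 + n)) → Paired 0 (join G H)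
join-paired {m} {n} G H = 2 , reindex +↔⊎ +↔⊎ record
  { at = two ⊕ two
  ; distinct = ⊕-injective two-injective two-injective
  ; covers = ↑-elim (Covered (join G H) (two ⊕ two))
      -- The pair lying in H covers G, and the one lying in G covers H.
      (λ x → inj₂ (inj₂ zero , acrossʳ zero x , acrossʳ (suc zero) x))
      (λ x → inj₂ (inj₁ zero , acrossˡ zero x , acrossˡ (suc zero) x))
  }
  where
  two : ∀ {n} → Slots (Fin 0) (Fin 1) → Fin (2 + n)
  two (left _)  = zero
  two (right _) = suc zero
  two-injective : ∀ {n} → Injective _≡_ _≡_ (two {n})
  two-injective {_} {left zero}  {left zero}  _ = refl
  two-injective {_} {right zero} {right zero} _ = refl
  acrossˡ : ∀ u x → N[_] (join G H) (u ↑ˡ (2 + n)) ((2 + m) ↑ʳ x)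
  acrossˡ u x = inj₂ (subst₂ (JoinAdj G H) (≡-sym (splitAt-↑ˡ (2 + m) u (2 + n))) (≡-sym (splitAt-↑ʳ (2 + m) (2 + n) x)) tt)
  acrossʳ : ∀ u x → N[_] (join G H) ((2 + m) ↑ʳ u) (x ↑ˡ (2 + n))
  acrossʳ u x = inj₂ (subst₂ (JoinAdj G H) (≡-sym (splitAt-↑ʳ (2 + m) (2 + n) u)) (≡-sym (splitAt-↑ˡ (2 + m) x (2 + n))) tt)

-- Cographs

-- The induction hypothesis. `vertex` records that cographs are nonempty: this excludes empty parts
-- in a join and a finished game at the start in a union.
record Extracts (G : Graph n) : Set where
  field
    vertex : Fin n
    first  : WinningStrategy G dominator (start n) → Paired 1 G
    second : WinningStrategy G staller (start n) → Paired 0 G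

open Extracts

≅-extracts : {G : Graph m} {H : Graph n} → G ≅ H → Extracts G → Extracts H
≅-extracts iso E = record
  { vertex = Inverse.to (_≅_.bijection iso) (vertex E)
  ; first  = ≅-paired iso ∘ first E ∘ ≅-strategy iso
  ; second = ≅-paired iso ∘ second E ∘ ≅-strategy iso
  }

union-extracts : {G : Graph m} {H : Graph n} → Extracts G → Extracts H → Extracts (disjointUnion G H)
union-extracts {n = n} {G = G} {H} E F = record
  { vertex = vertex E ↑ˡ n
  ; first  = [ (λ (σ , τ) → union-paired G H (first E σ) (second F τ))
             , (λ (σ , τ) → union-paired G H (second E σ) (first F τ))
             ]′ ∘ union-first G H (vertex E)
  ; second = λ σ → let σ₁ , σ₂ = union-second G H σ
                   in union-paired G H (second E σ₁) (second F σ₂)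
  }

apex-extracts : (G : Graph 1) {H : Graph n} → Extracts H → Extracts (join G H)
apex-extracts G {H} F = record
  { vertex = zero
  ; first  = λ _ → universal-paired zero (apex-nbhd G H)
  ; second = apex-pair G H ∘ first F ∘ apex-second G H
  }

join-extracts : {G : Graph m} {H : Graph n} → Extracts G → Extracts H → Extracts (join G H)
join-extracts {zero} E _ with () ← vertex E
join-extracts {suc _} {zero} _ F with () ← vertex F
join-extracts {1} {G = G} _ F = apex-extracts G F
join-extracts {suc (suc _)} {1} {G} {H} E _ = ≅-extracts (join-comm H G) (apex-extracts H E)
join-extracts {suc (suc _)} {suc (suc _)} {G} {H} _ _ = record
  { vertex = zero
  ; first  = λ _ → promote zero (join-paired G H)
  ; second = λ _ → join-paired G H
  }

K₁-extracts : Extracts K₁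
K₁-extracts = record
  { vertex = zero
  ; first  = λ _ → universal-paired {G = K₁} zero λ { zero → inj₁ refl }
  ; second = λ where
      (game-over full _)  → contradiction refl (full zero)
      (staller-moves _ σ) → contradiction (σ zero refl) lost
  }
  where
  -- Staller owns the only vertex, so Dominator has neither a move nor a vertex that dominates it.
  lost : ¬ WinningStrategy K₁ dominator (just staller ∷ [])
  lost (game-over _ dominating) with dominating zero
  ... | zero , () , _
  lost (dominator-moves zero () _)

cograph-extracts : {G : Graph n} → IsCograph G → Extracts G
cograph-extracts single-vertex        = K₁-extracts
cograph-extracts (disjoint-union g h) = union-extracts (cograph-extracts g) (cograph-extracts h)
cograph-extracts (graph-join g h)     = join-extracts (cograph-extracts g) (cograph-extracts h)
cograph-extracts (isomorphic iso g)   = ≅-extracts iso (cograph-extracts g)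

theorem6 : (n : ℕ) (G : Graph n) → IsCograph G → Outcome𝒟 G ⇔ PairingDominatingSet G
theorem6 n G cograph = mk⇔
  (λ (_ , σ) → pairingDominatingSet (second (cograph-extracts cograph) σ))
  (λ P → let σ = PairingStrategy.wins-second P in second⇒first G σ , σ)
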